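{- For every non-negative integer $k$ there is a Boolean function $f$ on $n=2k+1$ variables with $\mathrm{s}(f)=\mathrm{bs}(f)=\mathrm{RC}(f)=n=2k+1$ and $\mathrm{UC}_{\min}(f)\le k+1$.
   Context: For $f:\{0,1\}^n\to\{0,1\}$, $x\in\{0,1\}^n$ and $B\subseteq[n]$, $x^B$ is $x$ with the bits in $B$ flipped; $B$ is a sensitive block of $x$ if $f(x^B)\ne f(x)$. $\mathrm{s}(f)$ is the maximum over $x$ of the number of $i$ with $\{i\}$ sensitive for $x$; $\mathrm{bs}(f)$ is the maximum over $x$ of the maximum number of pairwise disjoint sensitive blocks of $x$; $\mathrm{RC}(f)$ is the maximum over $x$ of the maximum of $\sum_Ba_B$ over non-negative real weights $a_B$ on the sensitive blocks $B$ of $x$ with $\sum_{B\ni i}a_B\le1$ for every $i\in[n]$. Partial assignments are strings $p\in\{0,1,*\}^n$; $|p|$ is the number of non-$*$ entries; $p\subseteq x$ means $x$ agrees with $p$ on all non-$*$ entries; two partial assignments are consistent if they agree wherever neither has $*$. $p$ is a $b$-certificate if $f(x)=b$ for all $x\supseteq p$. An unambiguous collection of $b$-certificates is a set $U$ of $b$-certificates such that every $x\in f^{ -1}(b)$ satisfies $p\subseteq x$ for some $p\in U$, and no two distinct elements of $U$ are consistent. $\mathrm{UC}_b(f)$ is the minimum of $\max_{p\in U}|p|$ over such $U$, and $\mathrm{UC}_{\min}(f)=\min\{\mathrm{UC}_0(f),\mathrm{UC}_1(f)\}$. -}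

module Defs where

open import Algebra.Bundles using (CommutativeMonoid)
open import Data.Bool.Base using (Bool; true; false; _xor_)
import Data.Bool.Properties as Bool
open import Data.Fin.Subset using (Subset; inside; outside; _∩_; Empty; ⁅_⁆)
open import Data.Fin.Subset.Properties using () renaming (_∈?_ to _∈ₛ?_)
open import Data.Integer.Base using (+_)
open import Data.List.Base using (List; []; _∷_; _++_; map; filter; foldr; length; allFin)
open import Data.List.Membership.Propositional using (_∈_)
open import Data.List.Relation.Unary.All using (All)
open import Data.List.Relation.Unary.AllPairs using (AllPairs)
open import Data.Maybe.Base using (Maybe; just; is-just)
open import Data.Nat.Base as ℕ using (ℕ; zero; suc; _⊔_; _⊓_)
import Data.Nat.Properties as ℕ
open import Data.Product.Base using (∃-syntax; _×_; _,_)
open import Data.Rational.Base as ℚ using (ℚ; 0ℚ; ½)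
import Data.Rational.Properties as ℚ
open import Algebra.Properties.CommutativeSemigroup
  (CommutativeMonoid.commutativeSemigroup ℚ.+-0-commutativeMonoid) using (interchange)
open import Data.Vec.Base using (Vec; []; _∷_; lookup; zipWith; countᵇ)
open import Relation.Binary.Core using (Rel)
open import Relation.Binary.PropositionalEquality
  using (_≡_; _≢_; sym; trans; cong; subst; subst₂)
open import Relation.Nullary.Decidable using (Dec; ¬?)
open import Relation.Nullary.Negation using (¬_)
open import Relation.Unary using (Pred)
open import Level using (0ℓ)

IsMaximum IsMinimum : {A : Set} → Rel A 0ℓ → Pred A 0ℓ → Pred A 0ℓ
IsMaximum _≤_ P m = P m × (∀ k → P k → k ≤ m)
IsMinimum _≤_ P m = P m × (∀ k → P k → m ≤ k)

-- Real numbers as Cauchy sequences of rationals, with equality _≈_.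

record ℝ : Set where
  constructor mkℝ
  field
    seq    : ℕ → ℚ
    cauchy : ∀ ε → 0ℚ ℚ.< ε →
             ∃[ N ] (∀ m n → N ℕ.≤ m → N ℕ.≤ n → ℚ.∣ seq m ℚ.- seq n ∣ ℚ.< ε)

open ℝ public

infix 4 _≈_ _≤ℝ_
infixl 6 _+ℝ_

_≈_ : Rel ℝ 0ℓ
x ≈ y = ∀ ε → 0ℚ ℚ.< ε → ∃[ N ] (∀ n → N ℕ.≤ n → ℚ.∣ seq x n ℚ.- seq y n ∣ ℚ.< ε)

_≤ℝ_ : Rel ℝ 0ℓ
x ≤ℝ y = ∀ ε → 0ℚ ℚ.< ε → ∃[ N ] (∀ n → N ℕ.≤ n → seq x n ℚ.< seq y n ℚ.+ ε)

fromℚ : ℚ → ℝ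
fromℚ q = mkℝ (λ _ → q) λ ε 0<ε → 0 , λ _ _ _ _ →
  subst (ℚ._< ε) (sym (cong ℚ.∣_∣ (ℚ.+-inverseʳ q))) 0<ε

fromℕ : ℕ → ℝ
fromℕ n = fromℚ (+ n ℚ./ 1)

private
  half-pos : ∀ ε → 0ℚ ℚ.< ε → 0ℚ ℚ.< ½ ℚ.* ε
  half-pos ε 0<ε = subst (ℚ._< ½ ℚ.* ε) (ℚ.*-zeroʳ ½) (ℚ.*-monoʳ-<-pos ½ 0<ε)

  half+half : ∀ ε → ½ ℚ.* ε ℚ.+ ½ ℚ.* ε ≡ ε
  half+half ε = trans (sym (ℚ.*-distribʳ-+ ε ½ ½)) (ℚ.*-identityˡ ε)

  regroup : ∀ a b c d → (a ℚ.- b) ℚ.+ (c ℚ.- d) ≡ (a ℚ.+ c) ℚ.- (b ℚ.+ d)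
  regroup a b c d = trans (interchange a (ℚ.- b) c (ℚ.- d))
    (cong ((a ℚ.+ c) ℚ.+_) (sym (ℚ.neg-distrib-+ b d)))

_+ℝ_ : ℝ → ℝ → ℝ
x +ℝ y = mkℝ (λ n → seq x n ℚ.+ seq y n) λ ε 0<ε →
  let M , p = cauchy x (½ ℚ.* ε) (half-pos ε 0<ε)
      N , q = cauchy y (½ ℚ.* ε) (half-pos ε 0<ε)
      M≤  = λ {m} (h : M ⊔ N ℕ.≤ m) → ℕ.≤-trans (ℕ.m≤m⊔n M N) h
      N≤  = λ {m} (h : M ⊔ N ℕ.≤ m) → ℕ.≤-trans (ℕ.m≤n⊔m M N) h
  in M ⊔ N , λ m n hm hn →
    subst₂ ℚ._<_ (cong ℚ.∣_∣ (regroup (seq x m) (seq x n) (seq y m) (seq y n))) (half+half ε)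
      (ℚ.≤-<-trans (ℚ.∣p+q∣≤∣p∣+∣q∣ (seq x m ℚ.- seq x n) (seq y m ℚ.- seq y n))
        (ℚ.+-mono-< (p m n (M≤ hm) (M≤ hn)) (q m n (N≤ hm) (N≤ hn))))

∑ : ∀ {A : Set} → List A → (A → ℝ) → ℝ
∑ xs g = foldr (λ x s → g x +ℝ s) (fromℕ 0) xs

Input : ℕ → Set
Input n = Vec Bool n

BoolFun : ℕ → Set
BoolFun n = Input n → Bool

infixl 8 _^_

_^_ : ∀ {n} → Input n → Subset n → Input n
x ^ B = zipWith _xor_ x B

Sensitive : ∀ {n} → BoolFun n → Input n → Subset n → Set
Sensitive f x B = f (x ^ B) ≢ f x

sensitive? : ∀ {n} (f : BoolFun n) x B → Dec (Sensitive f x B)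
sensitive? f x B = ¬? (f (x ^ B) Bool.≟ f x)

sensitivityAt : ∀ {n} → BoolFun n → Input n → ℕ
sensitivityAt {n} f x = length (filter (λ i → sensitive? f x ⁅ i ⁆) (allFin n))

IsSensitivity : ∀ {n} → BoolFun n → ℕ → Set
IsSensitivity f = IsMaximum ℕ._≤_ (λ m → ∃[ x ] sensitivityAt f x ≡ m)

Disjoint : ∀ {n} → Subset n → Subset n → Set
Disjoint A B = Empty (A ∩ B)

-- Sensitive blocks are non-empty, so pairwise disjointness of a list of them
-- forces its members to be distinct.
IsDisjointSensitiveFamily : ∀ {n} → BoolFun n → Input n → List (Subset n) → Set
IsDisjointSensitiveFamily f x 𝓑 = All (Sensitive f x) 𝓑 × AllPairs Disjoint 𝓑

-- Here and in IsRC the iterated maximum (over x, then over families or weights)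
-- is one maximum over pairs.
IsBlockSensitivity : ∀ {n} → BoolFun n → ℕ → Set
IsBlockSensitivity f = IsMaximum ℕ._≤_
  (λ m → ∃[ x ] ∃[ 𝓑 ] IsDisjointSensitiveFamily f x 𝓑 × length 𝓑 ≡ m)

subsets : ∀ n → List (Subset n)
subsets zero    = [] ∷ []
subsets (suc n) = map (outside ∷_) (subsets n) ++ map (inside ∷_) (subsets n)

sensitiveBlocks : ∀ {n} → BoolFun n → Input n → List (Subset n)
sensitiveBlocks {n} f x = filter (sensitive? f x) (subsets n)

-- The values of a weighting outside the sensitive blocks are never used.
Weighting : ℕ → Set
Weighting n = Subset n → ℝ

record IsFeasible {n} (f : BoolFun n) (x : Input n) (a : Weighting n) : Set where
  field
    nonNegative : ∀ B → Sensitive f x B → fromℕ 0 ≤ℝ a B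
    packing     : ∀ i → ∑ (filter (i ∈ₛ?_) (sensitiveBlocks f x)) a ≤ℝ fromℕ 1

IsRC : ∀ {n} → BoolFun n → ℝ → Set
IsRC f = IsMaximum _≤ℝ_
  (λ r → ∃[ x ] ∃[ a ] IsFeasible f x a × ∑ (sensitiveBlocks f x) a ≈ r)

-- Partial assignments, with `nothing` for *.
Partial : ℕ → Set
Partial n = Vec (Maybe Bool) n

size : ∀ {n} → Partial n → ℕ
size p = countᵇ is-just p

infix 4 _⊑_

_⊑_ : ∀ {n} → Partial n → Input n → Set
p ⊑ x = ∀ i b → lookup p i ≡ just b → lookup x i ≡ b

Consistent : ∀ {n} → Partial n → Partial n → Set
Consistent p q = ∀ i b c → lookup p i ≡ just b → lookup q i ≡ just c → b ≡ c

IsCertificate : ∀ {n} → BoolFun n → Bool → Partial n → Set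
IsCertificate f b p = ∀ x → p ⊑ x → f x ≡ b

-- The finite set U is represented by any list of its elements; repetitions are
-- harmless because only distinct elements have to be inconsistent.
record IsUnambiguous {n} (f : BoolFun n) (b : Bool) (U : List (Partial n)) : Set where
  field
    certificates : ∀ p → p ∈ U → IsCertificate f b p
    covers       : ∀ x → f x ≡ b → ∃[ p ] p ∈ U × p ⊑ x
    inconsistent : ∀ p q → p ∈ U → q ∈ U → p ≢ q → ¬ Consistent p q

-- The empty collection, which is unambiguous when f never takes the value b,
-- has width 0.
width : ∀ {n} → List (Partial n) → ℕ
width U = foldr _⊔_ 0 (map size U)

IsUC : ∀ {n} → Bool → BoolFun n → ℕ → Set
IsUC b f = IsMinimum ℕ._≤_ (λ w → ∃[ U ] IsUnambiguous f b U × width U ≡ w)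

IsUCmin : ∀ {n} → BoolFun n → ℕ → Set
IsUCmin f u = ∃[ u₀ ] ∃[ u₁ ] IsUC false f u₀ × IsUC true f u₁ × u ≡ u₀ ⊓ u₁

{-# OPTIONS --safe #-}

-- A tournament on the n = 2k+1 variables in which every vertex beats k others
-- gives n partial assignments, the i-th one being 1 at i, 0 at the variables
-- beaten by i and * elsewhere.  They have size k+1 and, as one of i, j beats the
-- other, are pairwise inconsistent; f is true where one of them applies.  Then f
-- is false at 0 but true at every input of weight one, so s, bs and RC all equal n
-- (RC by weighting the singletons, and n bounds any fractional packing of
-- non-empty blocks).  A 0-certificate of the input 0 fixes every variable, so
-- UC_0(f) = n, and double counting over the certificates of the inputs of weight
-- one gives UC_1(f) = k+1, hence UC_min(f) exists and equals min(n, k+1).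

module Submission where

open import Defs
open import Data.Bool.Base using (Bool; true; false; if_then_else_)
import Data.Bool.Properties as Bool
import Data.Fin.Properties as Fin
open import Data.Fin.Base using (Fin; zero; suc; toℕ)
open import Data.Fin.Subset using (Subset; ⊥; inside; outside; Nonempty; ⁅_⁆; ∣_∣)
  renaming (_∈_ to _∈ₛ_)
open import Data.Fin.Subset.Properties
  using (_∈?_; nonempty?; Empty-unique; x∈p∩q⁺; x∈p∩q⁻; x∈⁅x⁆; x∈⁅y⁆⇒x≡y)
open import Data.Integer.Base as ℤ using (+_)
import Data.Integer.Properties as ℤ
open import Data.List.Base as List using (List; []; _∷_; filter; length; allFin)
open import Data.List.Membership.Propositional using (_∈_)
open import Data.List.Membership.Propositional.Properties
  using (∈-allFin; ∈-++⁺ˡ; ∈-++⁺ʳ; ∈-map⁺;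
    ∈-map⁻; ∈-filter⁺; ∈-filter⁻; ∈-tabulate⁺; ∈-tabulate⁻)
open import Data.List.Properties
  using (filter-accept; filter-reject; filter-all; length-filter; length-tabulate;
    map-++; map-∘; map-cong)
open import Data.List.Relation.Unary.All as All using (All; []; _∷_)
import Data.List.Relation.Unary.All.Properties as All
open import Data.List.Relation.Unary.AllPairs using (AllPairs; []; _∷_)
import Data.List.Relation.Unary.AllPairs.Properties as AllPairs
open import Data.List.Relation.Binary.Sublist.Propositional using (_⊆_; []; _∷_; _∷ʳ_)
import Data.List.Relation.Binary.Sublist.Propositional.Properties as Sublist
open import Data.List.Relation.Unary.Any using (here; there)
open import Data.Maybe.Base using (Maybe; just; nothing; is-just)
open import Data.Maybe.Properties using (just-injective)
open import Data.Nat using (_+_; _*_; _≤_)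
open import Data.Nat.Base as ℕ using (ℕ; zero; suc; _⊔_; ⌊_/2⌋; ⌈_/2⌉; parity)
open import Data.Nat.ListAction using (sum)
open import Data.Nat.ListAction.Properties using (sum-++)
import Data.Nat.Properties as ℕ
open import Data.Nat.Coprimality as C using (1-coprimeTo)
open import Data.Parity.Base using (Parity; 0ℙ; 1ℙ; _⁻¹)
open import Data.Parity.Properties using (suc-homo-⁻¹)
open import Data.Product.Base using (Σ-syntax; ∃-syntax; _×_; _,_; proj₁; proj₂)
open import Data.Sum.Base using (_⊎_; inj₁; inj₂)
open import Data.Vec.Base as Vec using (Vec; []; _∷_; here; there; lookup)
open import Data.Vec.Properties
  using (count≤n; lookup⇒[]=; []=⇒lookup; lookup-map; lookup-replicate;
    lookup∘tabulate; zipWith-identityˡ; zipWith-identityʳ)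
open import Data.Rational.Base as ℚ using (ℚ; 0ℚ; 1ℚ; ½)
open import Data.Rational.Literals using (fromℤ)
import Data.Rational.Properties as ℚ
open import Function.Base using (_∘_; const; case_of_)
open import Level using (0ℓ)
open import Relation.Binary.PropositionalEquality
open import Relation.Nullary.Decidable using (Dec; does; yes; no; T?; map′; dec-true; dec-false)
open import Relation.Nullary.Negation using (contradiction)
open import Relation.Unary using (Pred; Decidable)
open import Algebra.Bundles using (CommutativeMonoid)
open import Algebra.Properties.AbelianGroup ℚ.+-0-abelianGroup
  using (xyx⁻¹≈y; ⁻¹-anti-homo-//)
open import Algebra.Properties.CommutativeMonoid.Sum ℕ.+-0-commutativeMonoid
  using (sum-syntax; sum-cong-≗; ∑-distrib-+; ∑-comm)
open import Algebra.Properties.CommutativeSemigroup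
  (CommutativeMonoid.commutativeSemigroup ℚ.+-0-commutativeMonoid)
  using (interchange; x∙yz≈y∙xz)

private
  variable
    A : Set
    n : ℕ

-- Natural numbers inside the rationals

cast : ℕ → ℚ
cast m = + m ℚ./ 1

-- The gcd in `_/_` does not reduce for a variable `m`, whereas `fromℤ` is a literal fraction with
-- denominator 1, on which sums and comparisons unfold to integers.
cast≡fromℤ : ∀ m → cast m ≡ fromℤ (+ m)
cast≡fromℤ m = ℚ.normalize-coprime (C.sym (1-coprimeTo m))

cast-+ : ∀ l m → cast (l ℕ.+ m) ≡ cast l ℚ.+ cast m
cast-+ l m = begin
  cast (l ℕ.+ m)
    ≡⟨ cong₂ (λ x y → (x ℤ.+ y) ℚ./ 1) (ℤ.*-identityʳ (+ l)) (ℤ.*-identityʳ (+ m)) ⟨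
  (+ l ℤ.* ℤ.1ℤ ℤ.+ + m ℤ.* ℤ.1ℤ) ℚ./ 1         ≡⟨⟩
  fromℤ (+ l) ℚ.+ fromℤ (+ m)                   ≡⟨ cong₂ ℚ._+_ (cast≡fromℤ l) (cast≡fromℤ m) ⟨
  cast l ℚ.+ cast m                             ∎
  where open ≡-Reasoning

cast-mono-≤ : ∀ {l m} → l ℕ.≤ m → cast l ℚ.≤ cast m
cast-mono-≤ {l} {m} l≤m = subst₂ ℚ._≤_ (sym (cast≡fromℤ l)) (sym (cast≡fromℤ m))
  (ℚ.*≤* (ℤ.*-monoʳ-≤-nonNeg ℤ.1ℤ (ℤ.+≤+ l≤m)))

cast-cancel-< : ∀ {l m} → cast l ℚ.< cast m → l ℕ.< m
cast-cancel-< {l} {m} l<m = ℤ.drop‿+<+ (ℤ.*-cancelʳ-<-nonNeg ℤ.1ℤ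
  (ℚ.drop-*<* (subst₂ ℚ._<_ (cast≡fromℤ l) (cast≡fromℤ m) l<m)))

-- Order on the Cauchy reals

half-pos : ∀ {ε} → 0ℚ ℚ.< ε → 0ℚ ℚ.< ½ ℚ.* ε
half-pos {ε} 0<ε = subst (ℚ._< ½ ℚ.* ε) (ℚ.*-zeroʳ ½) (ℚ.*-monoʳ-<-pos ½ 0<ε)

half+half : ∀ ε → ½ ℚ.* ε ℚ.+ ½ ℚ.* ε ≡ ε
half+half ε = trans (sym (ℚ.*-distribʳ-+ ε ½ ½)) (ℚ.*-identityˡ ε)

seq≡⇒≈ : ∀ {x y} → (∀ m → seq x m ≡ seq y m) → x ≈ y
seq≡⇒≈ {x} {y} x≡y ε 0<ε = 0 , λ m _ → subst (ℚ._< ε)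
  (sym (cong ℚ.∣_∣ (trans (cong (ℚ._- seq y m) (x≡y m)) (ℚ.+-inverseʳ (seq y m))))) 0<ε

infix 4 _≼_

-- As _≤ℝ_ unfolds, its arguments cannot be inferred; those of a record can.
record _≼_ (x y : ℝ) : Set where
  constructor ≤ℝ⇒≼
  field
    ≼⇒≤ℝ : x ≤ℝ y

open _≼_

seq≤⇒≼ : ∀ {x y} → (∀ m → seq x m ℚ.≤ seq y m) → x ≼ y
seq≤⇒≼ {x} {y} x≤y .≼⇒≤ℝ ε 0<ε = 0 , λ m _ → ℚ.≤-<-trans (x≤y m)
  (subst (ℚ._< seq y m ℚ.+ ε) (ℚ.+-identityʳ (seq y m)) (ℚ.+-monoʳ-< (seq y m) 0<ε))

seq≡⇒≼ : ∀ {x y} → (∀ m → seq x m ≡ seq y m) → x ≼ y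
seq≡⇒≼ x≡y = seq≤⇒≼ (ℚ.≤-reflexive ∘ x≡y)

≼-refl : ∀ x → x ≼ x
≼-refl x = seq≡⇒≼ (λ _ → refl)

≼-trans : ∀ {x y z} → x ≼ y → y ≼ z → x ≼ z
≼-trans {x} {y} {z} (≤ℝ⇒≼ x≤y) (≤ℝ⇒≼ y≤z) .≼⇒≤ℝ ε 0<ε =
  let M , p = x≤y (½ ℚ.* ε) (half-pos 0<ε)
      N , q = y≤z (½ ℚ.* ε) (half-pos 0<ε)
  in M ⊔ N , λ m M⊔N≤m → begin-strict
    seq x m                              <⟨ p m (ℕ.m⊔n≤o⇒m≤o M N M⊔N≤m) ⟩
    seq y m ℚ.+ ½ ℚ.* ε                  <⟨ ℚ.+-monoˡ-< (½ ℚ.* ε) (q m (ℕ.m⊔n≤o⇒n≤o M N M⊔N≤m)) ⟩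
    seq z m ℚ.+ ½ ℚ.* ε ℚ.+ ½ ℚ.* ε      ≡⟨ ℚ.+-assoc (seq z m) _ _ ⟩
    seq z m ℚ.+ (½ ℚ.* ε ℚ.+ ½ ℚ.* ε)    ≡⟨ cong (seq z m ℚ.+_) (half+half ε) ⟩
    seq z m ℚ.+ ε                        ∎
  where open ℚ.≤-Reasoning

+ℝ-mono-≼ : ∀ x y u v → x ≼ y → u ≼ v → x +ℝ u ≼ y +ℝ v
+ℝ-mono-≼ x y u v (≤ℝ⇒≼ x≤y) (≤ℝ⇒≼ u≤v) .≼⇒≤ℝ ε 0<ε =
  let M , p = x≤y (½ ℚ.* ε) (half-pos 0<ε)
      N , q = u≤v (½ ℚ.* ε) (half-pos 0<ε)
  in M ⊔ N , λ m M⊔N≤m → begin-strict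
    seq x m ℚ.+ seq u m
      <⟨ ℚ.+-mono-< (p m (ℕ.m⊔n≤o⇒m≤o M N M⊔N≤m)) (q m (ℕ.m⊔n≤o⇒n≤o M N M⊔N≤m)) ⟩
    (seq y m ℚ.+ ½ ℚ.* ε) ℚ.+ (seq v m ℚ.+ ½ ℚ.* ε)
      ≡⟨ interchange (seq y m) _ (seq v m) _ ⟩
    (seq y m ℚ.+ seq v m) ℚ.+ (½ ℚ.* ε ℚ.+ ½ ℚ.* ε)
      ≡⟨ cong (seq y m ℚ.+ seq v m ℚ.+_) (half+half ε) ⟩
    (seq y m ℚ.+ seq v m) ℚ.+ ε ∎
  where open ℚ.≤-Reasoning

-- Since `y` is `x` plus `y - x`, a difference of absolute value below ε puts `y` below `x + ε`.
-- This carries a bound on a total weight over to any real equal to it.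
≈⇒≽ : ∀ {x y} → x ≈ y → y ≼ x
≈⇒≽ {x} {y} x≈y .≼⇒≤ℝ ε 0<ε =
  let N , p = x≈y ε 0<ε
  in N , λ m N≤m → begin-strict
    seq y m                                   ≡⟨ xyx⁻¹≈y (seq x m) (seq y m) ⟨
    seq x m ℚ.+ seq y m ℚ.- seq x m           ≡⟨ ℚ.+-assoc (seq x m) _ _ ⟩
    seq x m ℚ.+ (seq y m ℚ.- seq x m)         ≤⟨ ℚ.+-monoʳ-≤ (seq x m) (p≤∣p∣ _) ⟩
    seq x m ℚ.+ ℚ.∣ seq y m ℚ.- seq x m ∣
      ≡⟨ cong (seq x m ℚ.+_) (∣p-q∣≡∣q-p∣ (seq y m) (seq x m)) ⟩
    seq x m ℚ.+ ℚ.∣ seq x m ℚ.- seq y m ∣     <⟨ ℚ.+-monoʳ-< (seq x m) (p m N≤m) ⟩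
    seq x m ℚ.+ ε                         ∎
  where
  open ℚ.≤-Reasoning
  p≤∣p∣ : ∀ p → p ℚ.≤ ℚ.∣ p ∣
  p≤∣p∣ p with ℚ.≤-total 0ℚ p
  ... | inj₁ 0≤p = ℚ.≤-reflexive (sym (ℚ.0≤p⇒∣p∣≡p 0≤p))
  ... | inj₂ p≤0 = ℚ.≤-trans p≤0 (ℚ.0≤∣p∣ p)
  ∣p-q∣≡∣q-p∣ : ∀ p q → ℚ.∣ p ℚ.- q ∣ ≡ ℚ.∣ q ℚ.- p ∣
  ∣p-q∣≡∣q-p∣ p q = trans (sym (ℚ.∣-p∣≡∣p∣ (p ℚ.- q))) (cong ℚ.∣_∣ (⁻¹-anti-homo-// p q))

fromℕ-mono-≤ : ∀ l m → l ℕ.≤ m → fromℕ l ≼ fromℕ m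
fromℕ-mono-≤ l m l≤m = seq≤⇒≼ (λ _ → cast-mono-≤ l≤m)

-- Taking ε = 1 gives `l < m + 1`, which for integers is `l ≤ m`. It brings the real packing bound
-- back to ℕ for block sensitivity.
fromℕ-cancel-≤ : ∀ {l m} → fromℕ l ≼ fromℕ m → l ℕ.≤ m
fromℕ-cancel-≤ {l} {m} (≤ℝ⇒≼ l≤m) =
  let N , p = l≤m 1ℚ (ℚ.positive⁻¹ 1ℚ)
  in ℕ.≤-pred (cast-cancel-< {l} {suc m} (subst (cast l ℚ.<_)
       (trans (ℚ.+-comm (cast m) 1ℚ) (sym (cast-+ 1 m))) (p N ℕ.≤-refl)))

-- Finite sums of reals and of natural numbers

seq-∑-fromℕ : (w : A → ℕ) (xs : List A) → ∀ m →
              seq (∑ xs (fromℕ ∘ w)) m ≡ cast (sum (List.map w xs))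
seq-∑-fromℕ w []       m = refl
seq-∑-fromℕ w (x ∷ xs) m = trans (cong (cast (w x) ℚ.+_) (seq-∑-fromℕ w xs m))
  (sym (cast-+ (w x) (sum (List.map w xs))))

∑-mono-≼ : (g h : A → ℝ) (xs : List A) → (∀ x → g x ≼ h x) → ∑ xs g ≼ ∑ xs h
∑-mono-≼ g h []       g≼h = ≼-refl (fromℕ 0)
∑-mono-≼ g h (x ∷ xs) g≼h = +ℝ-mono-≼ (g x) (h x) (∑ xs g) (∑ xs h) (g≼h x) (∑-mono-≼ g h xs g≼h)

-- The extra `c` is absorbed by the single term at `y`. In the packing bound `c` is the weight of a
-- new block and `y` one of its elements.
∑-mono-≼-+ : ∀ (g h : A → ℝ) c {y xs} → (∀ x → g x ≼ h x) →
             y ∈ xs → c +ℝ g y ≼ h y → c +ℝ ∑ xs g ≼ ∑ xs h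
∑-mono-≼-+ g h c {y} {_ ∷ xs} g≼h (here refl) c+g≼h =
  ≼-trans {c +ℝ (g y +ℝ ∑ xs g)} {c +ℝ g y +ℝ ∑ xs g} {h y +ℝ ∑ xs h}
    (seq≡⇒≼ λ m → sym (ℚ.+-assoc (seq c m) (seq (g y) m) (seq (∑ xs g) m)))
    (+ℝ-mono-≼ (c +ℝ g y) (h y) (∑ xs g) (∑ xs h) c+g≼h (∑-mono-≼ g h xs g≼h))
∑-mono-≼-+ g h c {xs = x ∷ xs} g≼h (there y∈xs) c+g≼h =
  ≼-trans {c +ℝ (g x +ℝ ∑ xs g)} {g x +ℝ (c +ℝ ∑ xs g)} {h x +ℝ ∑ xs h}
    (seq≡⇒≼ λ m → x∙yz≈y∙xz (seq c m) (seq (g x) m) (seq (∑ xs g) m))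
    (+ℝ-mono-≼ (g x) (h x) (c +ℝ ∑ xs g) (∑ xs h) (g≼h x) (∑-mono-≼-+ g h c g≼h y∈xs c+g≼h))

sum-const-1 : (xs : List A) → sum (List.map (const 1) xs) ≡ length xs
sum-const-1 []       = refl
sum-const-1 (x ∷ xs) = cong suc (sum-const-1 xs)

length-allFin : ∀ n → length (allFin n) ≡ n
length-allFin n = length-tabulate {n = n} (λ i → i)

-- Fractional packings of non-empty blocks

∑-∋ : Weighting n → List (Subset n) → Fin n → ℝ
∑-∋ a 𝓑 i = ∑ (filter (i ∈?_) 𝓑) a

∑-∋-∈ : ∀ (a : Weighting n) {B} 𝓑 {i} → i ∈ₛ B → a B +ℝ ∑-∋ a 𝓑 i ≼ ∑-∋ a (B ∷ 𝓑) i
∑-∋-∈ a {B} 𝓑 {i} i∈B =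
  subst (λ 𝓒 → a B +ℝ ∑-∋ a 𝓑 i ≼ ∑ 𝓒 a) (sym (filter-accept (i ∈?_) i∈B))
    (≼-refl (a B +ℝ ∑-∋ a 𝓑 i))

∑-∋-∷ : ∀ (a : Weighting n) {B} 𝓑 → fromℕ 0 ≼ a B → ∀ i → ∑-∋ a 𝓑 i ≼ ∑-∋ a (B ∷ 𝓑) i
∑-∋-∷ a {B} 𝓑 0≼aB i = case i ∈? B of λ
  { (yes i∈B) → ≼-trans {∑-∋ a 𝓑 i} {a B +ℝ ∑-∋ a 𝓑 i} {∑-∋ a (B ∷ 𝓑) i}
      (≼-trans {∑-∋ a 𝓑 i} {fromℕ 0 +ℝ ∑-∋ a 𝓑 i} {a B +ℝ ∑-∋ a 𝓑 i}
        (seq≡⇒≼ λ m → sym (ℚ.+-identityˡ (seq (∑-∋ a 𝓑 i) m)))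
        (+ℝ-mono-≼ (fromℕ 0) (a B) (∑-∋ a 𝓑 i) (∑-∋ a 𝓑 i) 0≼aB (≼-refl (∑-∋ a 𝓑 i))))
      (∑-∋-∈ a 𝓑 i∈B)
  ; (no i∉B)  → subst (λ 𝓒 → ∑-∋ a 𝓑 i ≼ ∑ 𝓒 a)
      (sym (filter-reject (i ∈?_) i∉B)) (≼-refl (∑-∋ a 𝓑 i)) }

-- Each block is non-empty, so its weight occurs in the sum of some element.
∑≼∑∑ : (a : Weighting n) (𝓑 : List (Subset n)) →
       All Nonempty 𝓑 → All (λ B → fromℕ 0 ≼ a B) 𝓑 →
       ∑ 𝓑 a ≼ ∑ (allFin n) (∑-∋ a 𝓑)
∑≼∑∑ {n} a [] [] [] = seq≤⇒≼ {fromℕ 0} {∑ (allFin n) (λ _ → fromℕ 0)} λ m →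
  ℚ.≤-trans (cast-mono-≤ {0} {sum (List.map (const 0) (allFin n))} ℕ.z≤n)
    (ℚ.≤-reflexive (sym (seq-∑-fromℕ (const 0) (allFin n) m)))
∑≼∑∑ {n} a (B ∷ 𝓑) ((i , i∈B) ∷ nonempty) (0≼aB ∷ 0≼a) =
  ≼-trans {a B +ℝ ∑ 𝓑 a} {a B +ℝ ∑ (allFin n) (∑-∋ a 𝓑)} {∑ (allFin n) (∑-∋ a (B ∷ 𝓑))}
    (+ℝ-mono-≼ (a B) (a B) (∑ 𝓑 a) (∑ (allFin n) (∑-∋ a 𝓑))
      (≼-refl (a B)) (∑≼∑∑ a 𝓑 nonempty 0≼a))
    (∑-mono-≼-+ (∑-∋ a 𝓑) (∑-∋ a (B ∷ 𝓑)) (a B)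
      (∑-∋-∷ a 𝓑 0≼aB) (∈-allFin i) (∑-∋-∈ a 𝓑 i∈B))

-- Each of the `n` elements carries load at most 1. The bound serves RC directly and block
-- sensitivity through constant weights 1.
packing≼n : (a : Weighting n) (𝓑 : List (Subset n)) →
            All Nonempty 𝓑 → All (λ B → fromℕ 0 ≼ a B) 𝓑 →
            (∀ i → ∑-∋ a 𝓑 i ≼ fromℕ 1) → ∑ 𝓑 a ≼ fromℕ n
packing≼n {n} a 𝓑 nonempty 0≼a packing =
  ≼-trans {∑ 𝓑 a} {∑ (allFin n) (∑-∋ a 𝓑)} {fromℕ n} (∑≼∑∑ a 𝓑 nonempty 0≼a)
    (≼-trans {∑ (allFin n) (∑-∋ a 𝓑)} {∑ (allFin n) (λ _ → fromℕ 1)} {fromℕ n}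
      (∑-mono-≼ (∑-∋ a 𝓑) (λ _ → fromℕ 1) (allFin n) packing)
      (seq≡⇒≼ λ m → trans (seq-∑-fromℕ (const 1) (allFin n) m)
        (cong cast (trans (sum-const-1 (allFin n)) (length-allFin n)))))

-- Counting singletons among all subsets

sum-filter : {P : Pred A 0ℓ} (P? : Decidable P) (w : A → ℕ) (xs : List A) →
             sum (List.map w (filter P? xs)) ≡
             sum (List.map (λ x → if does (P? x) then w x else 0) xs)
sum-filter P? w []       = refl
sum-filter P? w (x ∷ xs) with does (P? x)
... | false = sum-filter P? w xs
... | true  = cong (w x ℕ.+_) (sum-filter P? w xs)

-- A condition that holds on the support of a weight removes nothing; this is how the sensitivity
-- filter is dropped from a sum.
if-support : {P : Set} (P? : Dec P) (w : ℕ) → (w ≢ 0 → P) → (if does P? then w else 0) ≡ w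
if-support (yes _) w       _   = refl
if-support (no _)  zero    _   = refl
if-support (no ¬p) (suc w) ≢0⇒ = contradiction (≢0⇒ λ ()) ¬p

sum-zero : {w : A → ℕ} → (∀ x → w x ≡ 0) → (xs : List A) → sum (List.map w xs) ≡ 0
sum-zero w≡0 []       = refl
sum-zero w≡0 (x ∷ xs) = cong₂ ℕ._+_ (w≡0 x) (sum-zero w≡0 xs)

sum-subsets : ∀ n (w : Subset (suc n) → ℕ) →
              sum (List.map w (subsets (suc n))) ≡
              sum (List.map (w ∘ (outside ∷_)) (subsets n)) ℕ.+
              sum (List.map (w ∘ (inside ∷_)) (subsets n))
sum-subsets n w = begin
  sum (List.map w (outsides List.++ insides))                  ≡⟨ cong sum (map-++ w outsides insides) ⟩
  sum (List.map w outsides List.++ List.map w insides)         ≡⟨ sum-++ (List.map w outsides) _ ⟩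
  sum (List.map w outsides) ℕ.+ sum (List.map w insides)
    ≡⟨ cong₂ (λ ls rs → sum ls ℕ.+ sum rs) (map-∘ (subsets n)) (map-∘ (subsets n)) ⟨
  sum (List.map (w ∘ (outside ∷_)) (subsets n)) ℕ.+ sum (List.map (w ∘ (inside ∷_)) (subsets n)) ∎
  where
  open ≡-Reasoning
  outsides insides : List (Subset (suc n))
  outsides = List.map (outside ∷_) (subsets n)
  insides  = List.map (inside ∷_) (subsets n)

-- The indicator of cardinality `k`. Only 0 and 1 occur: deleting an inside head turns `weight 1`
-- into `weight 0` definitionally, which drives the inductions below.
weight : ℕ → Subset n → ℕ
weight k B = if ∣ B ∣ ℕ.≡ᵇ k then 1 else 0

∑weight₀≡1 : ∀ n → sum (List.map (weight 0) (subsets n)) ≡ 1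
∑weight₀≡1 zero    = refl
∑weight₀≡1 (suc n) = trans (sum-subsets n (weight 0))
  (cong₂ ℕ._+_ (∑weight₀≡1 n) (sum-zero (λ _ → refl) (subsets n)))

∑weight₁≡n : ∀ n → sum (List.map (weight 1) (subsets n)) ≡ n
∑weight₁≡n zero    = refl
∑weight₁≡n (suc n) = trans (sum-subsets n (weight 1))
  (trans (cong₂ ℕ._+_ (∑weight₁≡n n) (∑weight₀≡1 n)) (ℕ.+-comm n 1))

∈⇒weight₀≡0 : ∀ {i} {B : Subset n} → i ∈ₛ B → weight 0 B ≡ 0
∈⇒weight₀≡0 here                      = refl
∈⇒weight₀≡0 (there {y = inside}  i∈B) = refl
∈⇒weight₀≡0 (there {y = outside} i∈B) = ∈⇒weight₀≡0 i∈B

-- Among blocks through the first element only the one with empty tail counts; for a later `i`, a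
-- block that also contains the first element has two elements and weight 0.
∑∋weight₁≡1 : ∀ (i : Fin n) →
              sum (List.map (λ B → if does (i ∈? B) then weight 1 B else 0) (subsets n)) ≡ 1
∑∋weight₁≡1 {suc n} zero = trans
  (sum-subsets n (λ B → if does (zero ∈? B) then weight 1 B else 0))
  (cong₂ ℕ._+_ (sum-zero (λ _ → refl) (subsets n)) (∑weight₀≡1 n))
∑∋weight₁≡1 {suc n} (suc i) = trans
  (sum-subsets n (λ B → if does (suc i ∈? B) then weight 1 B else 0))
  (cong₂ ℕ._+_ (∑∋weight₁≡1 i) (sum-zero ∋⇒weight₀≡0 (subsets n)))
  where
  ∋⇒weight₀≡0 : ∀ B → (if does (i ∈? B) then weight 0 B else 0) ≡ 0
  ∋⇒weight₀≡0 B with i ∈? B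
  ... | no  _   = refl
  ... | yes i∈B = ∈⇒weight₀≡0 i∈B

∣p∣≡0⇒p≡⊥ : (p : Subset n) → ∣ p ∣ ≡ 0 → p ≡ ⊥
∣p∣≡0⇒p≡⊥ []            _     = refl
∣p∣≡0⇒p≡⊥ (outside ∷ p) ∣p∣≡0 = cong (outside ∷_) (∣p∣≡0⇒p≡⊥ p ∣p∣≡0)

weight₁≢0⇒singleton : (B : Subset n) → weight 1 B ≢ 0 → ∃[ i ] B ≡ ⁅ i ⁆
weight₁≢0⇒singleton []            w≢0 = contradiction refl w≢0
weight₁≢0⇒singleton (outside ∷ B) w≢0 = let i , eq = weight₁≢0⇒singleton B w≢0
  in suc i , cong (outside ∷_) eq
weight₁≢0⇒singleton (inside ∷ B)  w≢0 with ∣ B ∣ in ∣B∣≡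
... | zero  = zero , cong (inside ∷_) (∣p∣≡0⇒p≡⊥ B ∣B∣≡)
... | suc _ = contradiction refl w≢0

sum-⊆ : (w : A → ℕ) {xs ys : List A} → xs ⊆ ys → sum (List.map w xs) ℕ.≤ sum (List.map w ys)
sum-⊆ w []             = ℕ.z≤n
sum-⊆ w (y ∷ʳ xs⊆ys)   = ℕ.≤-trans (sum-⊆ w xs⊆ys) (ℕ.m≤n+m _ (w y))
sum-⊆ w (refl ∷ xs⊆ys) = ℕ.+-monoʳ-≤ _ (sum-⊆ w xs⊆ys)

-- Inputs, flips and agreement with partial assignments

^-identityˡ : (B : Subset n) → ⊥ ^ B ≡ B
^-identityˡ = zipWith-identityˡ (λ _ → refl)

^-identityʳ : (x : Input n) → x ^ ⊥ ≡ x
^-identityʳ = zipWith-identityʳ Bool.xor-identityʳ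

lookup-⁅⁆-≢ : ∀ (i j : Fin n) → j ≢ i → lookup ⁅ i ⁆ j ≡ false
lookup-⁅⁆-≢ i j j≢i = Bool.¬-not (λ eq → j≢i (x∈⁅y⁆⇒x≡y i (lookup⇒[]= j ⁅ i ⁆ eq)))

lookup-injective : {xs ys : Vec A n} → (∀ i → lookup xs i ≡ lookup ys i) → xs ≡ ys
lookup-injective {xs = []}     {[]}     _  = refl
lookup-injective {xs = x ∷ xs} {y ∷ ys} eq = cong₂ _∷_ (eq zero) (lookup-injective (eq ∘ suc))

∈-subsets : (B : Subset n) → B ∈ subsets n
∈-subsets []            = here refl
∈-subsets (outside ∷ B) = ∈-++⁺ˡ (∈-map⁺ (outside ∷_) (∈-subsets B))
∈-subsets {suc n} (inside ∷ B) =
  ∈-++⁺ʳ (List.map (outside ∷_) (subsets n)) (∈-map⁺ (inside ∷_) (∈-subsets B))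

-- A partial assignment cannot tell apart inputs that differ only where it is free. Both lower
-- bounds use this to force certificates to fix variables.
⊑-agree : ∀ (p : Partial n) (x y : Input n) i → lookup p i ≡ nothing →
          (∀ j → j ≢ i → lookup x j ≡ lookup y j) → p ⊑ x → p ⊑ y
⊑-agree p x y i pᵢ≡nothing x≗y p⊑x j b pⱼ≡b with j Fin.≟ i
... | yes refl = case trans (sym pᵢ≡nothing) pⱼ≡b of λ ()
... | no  j≢i  = trans (sym (x≗y j j≢i)) (p⊑x j b pⱼ≡b)

lookup-⊥-⁅⁆ : ∀ (i j : Fin n) → j ≢ i → lookup ⊥ j ≡ lookup ⁅ i ⁆ j
lookup-⊥-⁅⁆ i j j≢i = trans (lookup-replicate j false) (sym (lookup-⁅⁆-≢ i j j≢i))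

-- Size of partial assignments and width of collections

fixed : Partial n → Fin n → ℕ
fixed p i = if is-just (lookup p i) then 1 else 0

∑-fixed : (p : Partial n) → ∑[ i < n ] fixed p i ≡ size p
∑-fixed []            = refl
∑-fixed (just _ ∷ p)  = cong suc (∑-fixed p)
∑-fixed (nothing ∷ p) = ∑-fixed p

∑-const : ∀ n c → ∑[ i < n ] c ≡ n ℕ.* c
∑-const zero    c = refl
∑-const (suc n) c = cong (c ℕ.+_) (∑-const n c)

∑-mono : {t u : Fin n → ℕ} → (∀ i → t i ℕ.≤ u i) → ∑[ i < n ] t i ℕ.≤ ∑[ i < n ] u i
∑-mono {zero}  t≤u = ℕ.z≤n
∑-mono {suc n} t≤u = ℕ.+-mono-≤ (t≤u zero) (∑-mono (t≤u ∘ suc))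

size≤n : (p : Partial n) → size p ℕ.≤ n
size≤n p = count≤n (T? ∘ is-just) p

size-full : (p : Partial n) → (∀ i → lookup p i ≢ nothing) → size p ≡ n
size-full []            _    = refl
size-full (just _ ∷ p)  full = cong suc (size-full p (full ∘ suc))
size-full (nothing ∷ p) full = contradiction refl (full zero)

size≤width : ∀ {p} {U : List (Partial n)} → p ∈ U → size p ℕ.≤ width U
size≤width {U = q ∷ U} (here refl) = ℕ.m≤m⊔n (size q) (width U)
size≤width {U = q ∷ U} (there p∈U) = ℕ.≤-trans (size≤width p∈U) (ℕ.m≤n⊔m (size q) (width U))

width≤ : ∀ {w} (U : List (Partial n)) → (∀ p → p ∈ U → size p ℕ.≤ w) → width U ℕ.≤ w
width≤ []      _     = ℕ.z≤n
width≤ (p ∷ U) sizes = ℕ.⊔-lub (sizes p (here refl)) (width≤ U (λ q → sizes q ∘ there))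

-- Functions false at 0 and true at every input of weight one

module FullySensitive (f : BoolFun n) (f⊥ : f ⊥ ≡ false) (f⁅_⁆ : ∀ i → f ⁅ i ⁆ ≡ true) where

  sensitive⇒nonempty : ∀ x {B} → Sensitive f x B → Nonempty B
  sensitive⇒nonempty x {B} sens with nonempty? B
  ... | yes ne   = ne
  ... | no empty = contradiction
    (cong f (trans (cong (x ^_) (Empty-unique empty)) (^-identityʳ x))) sens

  singleton-sensitive : ∀ i → Sensitive f ⊥ ⁅ i ⁆
  singleton-sensitive i eq
    with () ← trans (sym f⁅ i ⁆) (trans (cong f (sym (^-identityˡ ⁅ i ⁆))) (trans eq f⊥))

  isSensitivity : IsSensitivity f n
  isSensitivity =
    (⊥ , trans (cong length (filter-all (λ i → sensitive? f ⊥ ⁅ i ⁆)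
                 (All.universal singleton-sensitive (allFin n)))) (length-allFin n)) ,
    λ { _ (x , refl) → ℕ.≤-trans
          (length-filter (λ i → sensitive? f x ⁅ i ⁆) (allFin n))
          (ℕ.≤-reflexive (length-allFin n)) }

  disjoint-singletons : ∀ {i j : Fin n} → i ≢ j → Disjoint ⁅ i ⁆ ⁅ j ⁆
  disjoint-singletons {i} {j} i≢j (l , l∈) =
    let l∈⁅i⁆ , l∈⁅j⁆ = x∈p∩q⁻ ⁅ i ⁆ ⁅ j ⁆ l∈
    in i≢j (trans (sym (x∈⁅y⁆⇒x≡y i l∈⁅i⁆)) (x∈⁅y⁆⇒x≡y j l∈⁅j⁆))

  isBlockSensitivity : IsBlockSensitivity f n
  isBlockSensitivity =
    (⊥ , List.tabulate ⁅_⁆ ,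
      (All.tabulate⁺ singleton-sensitive , AllPairs.tabulate⁺ disjoint-singletons) ,
      length-tabulate ⁅_⁆) ,
    λ { _ (x , 𝓑 , (sens , disj) , refl) → bound x 𝓑 sens disj }
    where
    overlap≤1 : ∀ i {𝓑 : List (Subset n)} → AllPairs Disjoint 𝓑 → All (i ∈ₛ_) 𝓑 → length 𝓑 ℕ.≤ 1
    overlap≤1 i []                _                 = ℕ.z≤n
    overlap≤1 i ([] ∷ _)          _                 = ℕ.≤-refl
    overlap≤1 i ((B∩C=∅ ∷ _) ∷ _) (i∈B ∷ i∈C ∷ _) =
      contradiction (i , x∈p∩q⁺ (i∈B , i∈C)) B∩C=∅
    bound : ∀ x 𝓑 → All (Sensitive f x) 𝓑 → AllPairs Disjoint 𝓑 → length 𝓑 ℕ.≤ n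
    -- With unit weights, disjointness says that every element carries load at most 1, so the
    -- fractional packing bound applies.
    bound x 𝓑 sens disj = subst (ℕ._≤ n) (sum-const-1 𝓑) (fromℕ-cancel-≤ (≼-trans
      {fromℕ (sum (List.map (const 1) 𝓑))} {∑ 𝓑 (const (fromℕ 1))} {fromℕ n}
      (seq≡⇒≼ λ m → sym (seq-∑-fromℕ (const 1) 𝓑 m))
      (packing≼n (const (fromℕ 1)) 𝓑 (All.map (sensitive⇒nonempty x) sens)
        (All.universal (λ _ → fromℕ-mono-≤ 0 1 ℕ.z≤n) 𝓑)
        λ i → ≼-trans {∑-∋ (const (fromℕ 1)) 𝓑 i}
          {fromℕ (sum (List.map (const 1) (filter (i ∈?_) 𝓑)))} {fromℕ 1}
          (seq≡⇒≼ (seq-∑-fromℕ (const 1) (filter (i ∈?_) 𝓑)))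
          (fromℕ-mono-≤ (sum (List.map (const 1) (filter (i ∈?_) 𝓑))) 1
            (subst (ℕ._≤ 1) (sym (sum-const-1 (filter (i ∈?_) 𝓑)))
            (overlap≤1 i (AllPairs.filter⁺ (i ∈?_) disj) (All.all-filter (i ∈?_) 𝓑)))))))

  singletonWeighting : Weighting n
  singletonWeighting B = fromℕ (weight 1 B)

  singletonWeighting-feasible : IsFeasible f ⊥ singletonWeighting
  singletonWeighting-feasible = record
    { nonNegative = λ B _ → ≼⇒≤ℝ (fromℕ-mono-≤ 0 (weight 1 B) ℕ.z≤n)
    ; packing     = λ i → ≼⇒≤ℝ (≼-trans {∑-∋ singletonWeighting (sensitiveBlocks f ⊥) i}
        {fromℕ (sum (List.map (weight 1) (filter (i ∈?_) (sensitiveBlocks f ⊥))))} {fromℕ 1}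
        (seq≡⇒≼ (seq-∑-fromℕ (weight 1) (filter (i ∈?_) (sensitiveBlocks f ⊥))))
        (fromℕ-mono-≤ (sum (List.map (weight 1) (filter (i ∈?_) (sensitiveBlocks f ⊥)))) 1 (begin
          sum (List.map (weight 1) (filter (i ∈?_) (sensitiveBlocks f ⊥)))
            -- Passing from the sensitive blocks to all blocks only adds non-negative terms.
            ≤⟨ sum-⊆ (weight 1) (Sublist.filter⁺ (i ∈?_) (i ∈?_) (λ { refl i∈B → i∈B })
                 (Sublist.filter-⊆ (sensitive? f ⊥) (subsets n))) ⟩
          sum (List.map (weight 1) (filter (i ∈?_) (subsets n)))
            ≡⟨ sum-filter (i ∈?_) (weight 1) (subsets n) ⟩
          sum (List.map (λ B → if does (i ∈? B) then weight 1 B else 0) (subsets n))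
            ≡⟨ ∑∋weight₁≡1 i ⟩
          1 ∎))) }
    where open ℕ.≤-Reasoning

  -- Every singleton is sensitive at `⊥`, so the restriction to sensitive blocks loses no weight and
  -- all `n` singletons are counted.
  singletonWeighting-total : ∑ (sensitiveBlocks f ⊥) singletonWeighting ≈ fromℕ n
  singletonWeighting-total = seq≡⇒≈ {∑ (sensitiveBlocks f ⊥) singletonWeighting} {fromℕ n} λ m →
    trans (seq-∑-fromℕ (weight 1) (sensitiveBlocks f ⊥) m) (cong cast (begin
      sum (List.map (weight 1) (sensitiveBlocks f ⊥))
        ≡⟨ sum-filter (sensitive? f ⊥) (weight 1) (subsets n) ⟩
      sum (List.map (λ B → if does (sensitive? f ⊥ B) then weight 1 B else 0) (subsets n))
        ≡⟨ cong sum (map-cong weight-insensitive (subsets n)) ⟩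
      sum (List.map (weight 1) (subsets n))
        ≡⟨ ∑weight₁≡n n ⟩
      n ∎))
    where
    open ≡-Reasoning
    weight-insensitive : ∀ B → (if does (sensitive? f ⊥ B) then weight 1 B else 0) ≡ weight 1 B
    weight-insensitive B = if-support (sensitive? f ⊥ B) (weight 1 B) λ w≢0 →
      let i , B≡⁅i⁆ = weight₁≢0⇒singleton B w≢0
      in subst (Sensitive f ⊥) (sym B≡⁅i⁆) (singleton-sensitive i)

  isRC : IsRC f (fromℕ n)
  isRC = (⊥ , singletonWeighting , singletonWeighting-feasible , singletonWeighting-total) ,
    λ { r (x , a , feasible , total) → bound r x a feasible total }
    where
    bound : ∀ r x a → IsFeasible f x a → ∑ (sensitiveBlocks f x) a ≈ r → r ≤ℝ fromℕ n
    bound r x a feasible total = ≼⇒≤ℝ (≼-trans {r} {∑ (sensitiveBlocks f x) a} {fromℕ n}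
      (≈⇒≽ {∑ (sensitiveBlocks f x) a} {r} total)
      (packing≼n a (sensitiveBlocks f x) (All.map (sensitive⇒nonempty x) sens)
        (All.map (λ {B} s → ≤ℝ⇒≼ (IsFeasible.nonNegative feasible B s)) sens)
        (λ i → ≤ℝ⇒≼ (IsFeasible.packing feasible i))))
      where
      sens : All (Sensitive f x) (sensitiveBlocks f x)
      sens = All.all-filter (sensitive? f x) (subsets n)

  -- If the certificate of `⊥` left `i` free, it would also apply to `⁅ i ⁆`, where `f` is true.
  UC₀-lower : ∀ U → IsUnambiguous f false U → n ℕ.≤ width U
  UC₀-lower U unamb =
    let p , p∈U , p⊑⊥ = covers ⊥ f⊥
        full i pᵢ≡nothing = case trans (sym (f⁅ i ⁆))
          (certificates p p∈U ⁅ i ⁆ (⊑-agree p ⊥ ⁅ i ⁆ i pᵢ≡nothing (lookup-⊥-⁅⁆ i) p⊑⊥)) of λ ()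
    in subst (ℕ._≤ width U) (size-full p full) (size≤width p∈U)
    where open IsUnambiguous unamb

  -- The bound is attained by the zeros of `f` taken as total assignments: any two distinct ones
  -- conflict.
  isUC₀ : IsUC false f n
  isUC₀ =
    (points , unamb , ℕ.≤-antisym (width≤ points sizes) (UC₀-lower points unamb)) ,
    λ { _ (U , unambU , refl) → UC₀-lower U unambU }
    where
    zeros : List (Input n)
    -- Inputs and subsets are both vectors of Booleans, so `subsets n` also enumerates the inputs.
    zeros = filter (λ x → f x Bool.≟ false) (subsets n)
    points : List (Partial n)
    points = List.map (Vec.map just) zeros
    sizes : ∀ p → p ∈ points → size p ℕ.≤ n
    sizes p p∈ with x , _ , refl ← ∈-map⁻ (Vec.map just) p∈ = size≤n (Vec.map just x)
    unamb : IsUnambiguous f false points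
    unamb = record
      { certificates = λ p p∈ y p⊑y → case ∈-map⁻ (Vec.map just) p∈ of λ
          { (x , x∈ , refl) → trans
              (cong f (lookup-injective λ i → p⊑y i (lookup x i) (lookup-map i just x)))
              (proj₂ (∈-filter⁻ (λ z → f z Bool.≟ false) {xs = subsets n} x∈)) }
      ; covers = λ x fx≡false → Vec.map just x ,
          ∈-map⁺ (Vec.map just) (∈-filter⁺ (λ z → f z Bool.≟ false) (∈-subsets x) fx≡false) ,
          λ i b eq → just-injective (trans (sym (lookup-map i just x)) eq)
      ; inconsistent = λ p q p∈ q∈ p≢q con →
          case (∈-map⁻ (Vec.map just) p∈ , ∈-map⁻ (Vec.map just) q∈) of λ
          { ((x , _ , refl) , (y , _ , refl)) → p≢q (cong (Vec.map just)
              (lookup-injective λ i → con i _ _ (lookup-map i just x) (lookup-map i just y))) }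
      }

  -- If q i is the certificate that applies to ⁅ i ⁆, then q i and q j can conflict
  -- only at i or at j, so q i fixes j or q j fixes i.
  UC₁-lower : ∀ U → IsUnambiguous f true U → n ℕ.≤ width U ℕ.+ width U
  UC₁-lower U unamb = *-cancel (begin
    n ℕ.* n                              ≡⟨ cong (n ℕ.*_) (ℕ.*-identityʳ n) ⟨
    n ℕ.* (n ℕ.* 1)                      ≡⟨ ∑-const n (n ℕ.* 1) ⟨
    ∑[ i < n ] (n ℕ.* 1)                 ≡⟨ sum-cong-≗ (λ (_ : Fin n) → ∑-const n 1) ⟨
    ∑[ i < n ] ∑[ j < n ] 1              ≤⟨ ∑-mono (λ i → ∑-mono (λ j → fixed-pair i j)) ⟩
    ∑[ i < n ] ∑[ j < n ] (fixed (q i) j ℕ.+ fixed (q j) i)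
      ≡⟨ sum-cong-≗ (λ i → ∑-distrib-+ (fixed (q i)) (λ j → fixed (q j) i)) ⟩
    ∑[ i < n ] (∑[ j < n ] fixed (q i) j ℕ.+ ∑[ j < n ] fixed (q j) i)
      ≡⟨ ∑-distrib-+ (λ i → ∑[ j < n ] fixed (q i) j) (λ i → ∑[ j < n ] fixed (q j) i) ⟩
    ∑[ i < n ] ∑[ j < n ] fixed (q i) j ℕ.+ ∑[ i < n ] ∑[ j < n ] fixed (q j) i
      ≡⟨ cong (total ℕ.+_) (∑-comm (λ i j → fixed (q j) i)) ⟩
    total ℕ.+ total                      ≤⟨ ℕ.+-mono-≤ total≤ total≤ ⟩
    n ℕ.* width U ℕ.+ n ℕ.* width U      ≡⟨ ℕ.*-distribˡ-+ n (width U) (width U) ⟨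
    n ℕ.* (width U ℕ.+ width U)          ∎)
    where
    open ℕ.≤-Reasoning
    open IsUnambiguous unamb
    *-cancel : ∀ {m l} → m ℕ.* m ℕ.≤ m ℕ.* l → m ℕ.≤ l
    *-cancel {zero}      _ = ℕ.z≤n
    *-cancel {m@(suc _)} h = ℕ.*-cancelˡ-≤ m h
    q : Fin n → Partial n
    q i = proj₁ (covers ⁅ i ⁆ f⁅ i ⁆)
    q∈U : ∀ i → q i ∈ U
    q∈U i = proj₁ (proj₂ (covers ⁅ i ⁆ f⁅ i ⁆))
    q⊑⁅⁆ : ∀ i → q i ⊑ ⁅ i ⁆
    q⊑⁅⁆ i = proj₂ (proj₂ (covers ⁅ i ⁆ f⁅ i ⁆))
    total : ℕ
    total = ∑[ i < n ] ∑[ j < n ] fixed (q i) j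
    total≤ : total ℕ.≤ n ℕ.* width U
    total≤ = ℕ.≤-trans
      (∑-mono (λ i → ℕ.≤-trans (ℕ.≤-reflexive (∑-fixed (q i))) (size≤width (q∈U i))))
      (ℕ.≤-reflexive (∑-const n (width U)))
    -- If `q i` were free at `i`, it would apply to `⊥`, where `f` is false. Hence `q i` differs
    -- from `q j` as soon as it leaves `j` free.
    diagonal : ∀ i → lookup (q i) i ≢ nothing
    diagonal i qᵢᵢ≡nothing = case trans (sym f⊥) (certificates (q i) (q∈U i) ⊥
      (⊑-agree (q i) ⁅ i ⁆ ⊥ i qᵢᵢ≡nothing
        (λ j → sym ∘ lookup-⊥-⁅⁆ i j) (q⊑⁅⁆ i))) of λ ()
    fixed-pair : ∀ i j → 1 ℕ.≤ fixed (q i) j ℕ.+ fixed (q j) i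
    fixed-pair i j with lookup (q i) j in qᵢⱼ | lookup (q j) i in qⱼᵢ
    ... | just _  | _       = ℕ.s≤s ℕ.z≤n
    ... | nothing | just _  = ℕ.s≤s ℕ.z≤n
    ... | nothing | nothing = contradiction consistent
      (inconsistent (q i) (q j) (q∈U i) (q∈U j) (λ qᵢ≡qⱼ → diagonal j
        (trans (cong (λ p → lookup p j) (sym qᵢ≡qⱼ)) qᵢⱼ)))
      where
      -- The only 1 of `⁅ i ⁆` is at `i`, where `q j` is free; wherever both certificates are fixed,
      -- `q i` is therefore 0. By symmetry so is `q j`, and the two are consistent.
      off-diagonal : ∀ {i j l b} → lookup (q j) i ≡ nothing → lookup (q i) l ≡ just b →
                     lookup (q j) l ≢ nothing → b ≡ false
      off-diagonal {i} {j} {l} {b} qⱼᵢ qᵢₗ qⱼₗ =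
        trans (sym (q⊑⁅⁆ i l b qᵢₗ)) (lookup-⁅⁆-≢ i l λ { refl → qⱼₗ qⱼᵢ })
      consistent : Consistent (q i) (q j)
      consistent l b c qᵢₗ qⱼₗ = trans
        (off-diagonal qⱼᵢ qᵢₗ λ eq → case trans (sym eq) qⱼₗ of λ ())
        (sym (off-diagonal qᵢⱼ qⱼₗ λ eq → case trans (sym eq) qᵢₗ of λ ()))

-- The certificates of the tournament

-- `0ℙ` stands for a beaten variable, fixed to 0, and `1ℙ` for a free one. For a later variable the
-- argument is the parity of the distance minus one, so odd distances give `0ℙ`; for an earlier one
-- it is inverted.
mark : Parity → Maybe Bool
mark 0ℙ = just false
mark 1ℙ = nothing

-- The zeros of the i-th certificate are the j that i beats in the tournament in
-- which i beats j iff i < j and j ∸ i is odd, or j < i and i ∸ j is even.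
entry : Fin n → Fin n → Maybe Bool
entry zero    zero    = just true
entry zero    (suc j) = mark (parity (toℕ j))
entry (suc i) zero    = mark (parity (toℕ i) ⁻¹)
entry (suc i) (suc j) = entry i j

row : Fin n → Partial n
row i = Vec.tabulate (entry i)

lookup-row : ∀ (i j : Fin n) → lookup (row i) j ≡ entry i j
lookup-row i = lookup∘tabulate (entry i)

entry-diagonal : (i : Fin n) → entry i i ≡ just true
entry-diagonal zero    = refl
entry-diagonal (suc i) = entry-diagonal i

mark≢true : ∀ {p} → mark p ≢ just true
mark≢true {0ℙ} ()
mark≢true {1ℙ} ()

entry-true⇒≡ : ∀ (i j : Fin n) → entry i j ≡ just true → i ≡ j
entry-true⇒≡ zero    zero    _  = refl
entry-true⇒≡ zero    (suc j) eq = contradiction eq mark≢true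
entry-true⇒≡ (suc i) zero    eq = contradiction eq mark≢true
entry-true⇒≡ (suc i) (suc j) eq = cong suc (entry-true⇒≡ i j eq)

-- The two entries of a pair are marks of inverse parities, so one of them is the mark of `0ℙ`.
entry-total : ∀ {i j : Fin n} → i ≢ j → entry i j ≡ just false ⊎ entry j i ≡ just false
entry-total {i = zero}  {zero}  0≢0 = contradiction refl 0≢0
entry-total {i = zero}  {suc j} _ with parity (toℕ j)
... | 0ℙ = inj₁ refl
... | 1ℙ = inj₂ refl
entry-total {i = suc i} {zero}  _ with parity (toℕ i)
... | 0ℙ = inj₂ refl
... | 1ℙ = inj₁ refl
entry-total {i = suc i} {suc j} i≢j = entry-total (i≢j ∘ cong suc)

size-marks : ∀ n → size (Vec.tabulate {n = n} (mark ∘ parity ∘ toℕ)) ≡ ⌈ n /2⌉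
size-marks zero          = refl
size-marks (suc zero)    = refl
size-marks (suc (suc n)) = cong suc (size-marks n)

-- Consecutive numbers have opposite parities, so exactly one of the two leading entries is fixed.
-- These are the entries that precede `row i` in `row (suc (suc i))`.
size-mark-suc : ∀ m (p : Partial n) →
                size (mark (parity (suc m) ⁻¹) ∷ mark (parity m ⁻¹) ∷ p) ≡ suc (size p)
size-mark-suc m p rewrite suc-homo-⁻¹ m with parity m
... | 0ℙ = refl
... | 1ℙ = refl

-- Two new variables in front add one fixed entry to the row and one to `⌊ n /2⌋`, so the induction
-- descends by two to the rows of the first two variables.
size-row : (i : Fin n) → size (row i) ℕ.≤ suc ⌊ n /2⌋
size-row {suc n} zero = ℕ.s≤s (ℕ.≤-reflexive (size-marks n))
-- The second variable does not beat the first, so the entry before the diagonal is free.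
size-row {suc (suc n)} (suc zero) = ℕ.s≤s
  (ℕ.≤-trans (ℕ.≤-reflexive (size-marks n)) (ℕ.⌊n/2⌋-mono (ℕ.n≤1+n (suc n))))
size-row {suc (suc n)} (suc (suc i)) =
  ℕ.≤-trans (ℕ.≤-reflexive (size-mark-suc (toℕ i) (row i))) (ℕ.s≤s (size-row i))

-- The tournament function and its unambiguous collection

rows : ∀ n → List (Partial n)
rows n = List.tabulate row

_⊑?_ : (p : Partial n) (x : Input n) → Dec (p ⊑ x)
p ⊑? x = Fin.all? agree?
  where
  agree? : ∀ i → Dec (∀ b → lookup p i ≡ just b → lookup x i ≡ b)
  agree? i with lookup p i
  ... | nothing = yes λ _ ()
  ... | just b  = map′ (λ { xᵢ≡b _ refl → xᵢ≡b }) (λ h → h b refl) (lookup x i Bool.≟ b)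

matches? : (x : Input n) → Dec (∃[ i ] row i ⊑ x)
matches? x = Fin.any? (λ i → row i ⊑? x)

tournamentFun : ∀ n → BoolFun n
tournamentFun n x = does (matches? x)

-- Every row demands a 1 on its diagonal.
tournamentFun-⊥ : ∀ n → tournamentFun n ⊥ ≡ false
tournamentFun-⊥ n = dec-false (matches? (⊥ {n})) λ (i , rowᵢ⊑⊥) →
  case trans (sym (rowᵢ⊑⊥ i true (trans (lookup-row i i) (entry-diagonal i))))
    (lookup-replicate i false) of λ ()

row⊑⁅⁆ : (i : Fin n) → row i ⊑ ⁅ i ⁆
row⊑⁅⁆ i j b eq with trans (sym (lookup-row i j)) eq
row⊑⁅⁆ i j true  eq | eᵢⱼ with refl ← entry-true⇒≡ i j eᵢⱼ = []=⇒lookup (x∈⁅x⁆ i)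
row⊑⁅⁆ i j false eq | eᵢⱼ =
  lookup-⁅⁆-≢ i j λ { refl → case trans (sym (entry-diagonal i)) eᵢⱼ of λ () }

tournamentFun-⁅⁆ : ∀ n (i : Fin n) → tournamentFun n ⁅ i ⁆ ≡ true
tournamentFun-⁅⁆ n i = dec-true (matches? ⁅ i ⁆) (i , row⊑⁅⁆ i)

rows-unambiguous : ∀ n → IsUnambiguous (tournamentFun n) true (rows n)
rows-unambiguous n = record
  { certificates = λ p p∈ x p⊑x → case ∈-tabulate⁻ p∈ of λ
      { (i , refl) → dec-true (matches? x) (i , p⊑x) }
  ; covers = λ x fx≡true → let i , rowᵢ⊑x = does-true⇒ (matches? x) fx≡true in
      row i , ∈-tabulate⁺ i , rowᵢ⊑x
  ; inconsistent = λ p q p∈ q∈ p≢q con → case (∈-tabulate⁻ p∈ , ∈-tabulate⁻ q∈) of λ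
      { ((i , refl) , (j , refl)) → case entry-total {i = i} {j} (p≢q ∘ cong row) of λ
        -- The loser's row has its diagonal 1 exactly where the winner's row has a 0.
        { (inj₁ eᵢⱼ) → case con j false true (trans (lookup-row i j) eᵢⱼ)
            (trans (lookup-row j j) (entry-diagonal j)) of λ ()
        ; (inj₂ eⱼᵢ) → case con i true false (trans (lookup-row i i) (entry-diagonal i))
            (trans (lookup-row j i) eⱼᵢ) of λ () } } }
  where
  does-true⇒ : ∀ {P : Set} (P? : Dec P) → does P? ≡ true → P
  does-true⇒ (yes p) _ = p

width-rows : ∀ n → width (rows n) ℕ.≤ suc ⌊ n /2⌋
width-rows n = width≤ (rows n) λ p p∈ → case ∈-tabulate⁻ p∈ of λ { (i , refl) → size-row i }

-- Arithmetic of 2k+1 and the theorem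

⌊2k+1/2⌋≡k : ∀ k → ⌊ 2 ℕ.* k ℕ.+ 1 /2⌋ ≡ k
⌊2k+1/2⌋≡k k = trans (cong ⌊_/2⌋ (ℕ.+-comm (2 ℕ.* k) 1))
  -- `⌈ m /2⌉` is by definition `⌊ suc m /2⌋`, so the lemma on the ceiling of `k + k` applies.
  (trans (cong (λ m → ⌊ suc (k ℕ.+ m) /2⌋) (ℕ.+-identityʳ k)) (sym (ℕ.n≡⌈n+n/2⌉ k)))

-- Double counting yields only `n ≤ w + w`; as `n` is odd and `w + w` even, halving rounds up to
-- `k + 1`.
2k+1≤w+w⇒k+1≤w : ∀ {k w} → 2 ℕ.* k ℕ.+ 1 ℕ.≤ w ℕ.+ w → k ℕ.+ 1 ℕ.≤ w
2k+1≤w+w⇒k+1≤w {k} {w} 2k+1≤2w = ℕ.≤-trans (ℕ.≤-reflexive (ℕ.+-comm k 1)) (ℕ.≰⇒> λ w≤k →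
  ℕ.<-irrefl refl (begin-strict
    w ℕ.+ w          ≤⟨ ℕ.+-mono-≤ w≤k w≤k ⟩
    k ℕ.+ k          ≡⟨ cong (k ℕ.+_) (ℕ.+-identityʳ k) ⟨
    2 ℕ.* k          <⟨ ℕ.n<1+n (2 ℕ.* k) ⟩
    suc (2 ℕ.* k)    ≡⟨ ℕ.+-comm 1 (2 ℕ.* k) ⟩
    2 ℕ.* k ℕ.+ 1    ≤⟨ 2k+1≤2w ⟩
    w ℕ.+ w          ∎))
  where open ℕ.≤-Reasoning

mainTheorem10 : (k : ℕ) →
    Σ[ f ∈ BoolFun (2 * k + 1) ]
    (IsSensitivity f (2 * k + 1)
    × IsBlockSensitivity f (2 * k + 1)
    × IsRC f (fromℕ (2 * k + 1))
    × (∃[ u ] (IsUCmin f u × u ≤ k + 1)))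
mainTheorem10 k = tournamentFun N , isSensitivity , isBlockSensitivity , isRC ,
  -- The omitted value is forced by `refl` to be `N ⊓ (k + 1)`.
  _ , (N , k + 1 , isUC₀ , isUC₁ , refl) , ℕ.m⊓n≤n N (k + 1)
  where
  N = 2 * k + 1
  open FullySensitive (tournamentFun N) (tournamentFun-⊥ N) (tournamentFun-⁅⁆ N)
  width≤k+1 : width (rows N) ≤ k + 1
  width≤k+1 = subst (width (rows N) ≤_)
    (trans (cong suc (⌊2k+1/2⌋≡k k)) (ℕ.+-comm 1 k)) (width-rows N)
  k+1≤width : ∀ U → IsUnambiguous (tournamentFun N) true U → k + 1 ≤ width U
  k+1≤width U unamb = 2k+1≤w+w⇒k+1≤w (UC₁-lower U unamb)
  isUC₁ : IsUC true (tournamentFun N) (k + 1)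
  isUC₁ =
    (rows N , rows-unambiguous N ,
      ℕ.≤-antisym width≤k+1 (k+1≤width (rows N) (rows-unambiguous N))) ,
    λ { _ (U , unamb , refl) → k+1≤width U unamb }
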